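{- If there exists a depth assignment $d:\Sigma^n\to\Sigma$ such that the valid subgraph of $B_n$ has a Hamiltonian cycle, then such a cycle $s_0,s_1,\dots,s_{N-1}$ (with $N=k^n$) corresponds to a de Bruijn sequence $s_0[0]s_1[0]\cdots s_{N-1}[0]$ of order $n$ whose discrepancy is at most $n+1$.
   Context: Let $k\ge 1$ be an integer, $\Sigma=\{0,1,\dots,k-1\}$ with arithmetic on symbols taken modulo $k$, and $n\ge 1$. For $s\in\Sigma^n$ write $s=s[0]\cdots s[n-1]$. The de Bruijn graph $B_n$ has node set $\Sigma^n$ and an arc $(s,t)$ iff $s[1]\cdots s[n-1]=t[0]\cdots t[n-2]$. A depth assignment is any function $d:\Sigma^n\to\Sigma$, written $s\mapsto d_s$. An arc $(s,t)$ of $B_n$ is valid (with respect to $d$) if, with $b=s[0]$ and $c=t[n-1]$, either ($b+1=c$ and $d_s=d_t$) or ($b+1=d_t$ and $c=d_s$); the valid arcs (on all of $\Sigma^n$) form the valid subgraph. A de Bruijn sequence of order $n$ is a circular string of length $k^n$ in which every string in $\Sigma^n$ occurs exactly once. The discrepancy of a string $w$ is the maximum over all substrings $s$ of $w$ (viewed circularly) of $\max_{a\in\Sigma}|s|_a-\min_{c\in\Sigma}|s|_c$, where $|s|_a$ is the number of occurrences of $a$ in $s$. -}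

module Defs where

open import Data.Nat using (ℕ; suc; _+_; _∸_; _^_)
open import Data.Nat.DivMod using (_mod_)
open import Data.Fin using (Fin; toℕ; _≟_)
open import Data.Fin.Properties using (nonZeroIndex)
open import Data.List as List using (List; allFin; upTo; cartesianProductWith)
open import Data.List.Extrema.Nat using (max; min)
open import Data.Product using (_×_; ∃!)
open import Data.Sum using (_⊎_)
open import Data.Vec using (Vec; head; tail; init; last; tabulate; count)
open import Function using (Bijective)
open import Level using (0ℓ)
open import Relation.Binary using (Rel)
open import Relation.Binary.PropositionalEquality using (_≡_)

-- Addition modulo N, used both for symbols (N = k) and for circular positions.
infixl 6 _⊕_
_⊕_ : ∀ {N} → Fin N → ℕ → Fin N
_⊕_ {N} i j = ((toℕ i + j) mod N) {{nonZeroIndex i}}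

Word : ℕ → ℕ → Set
Word k n = Vec (Fin k) n

Arc : ∀ {k m} → Rel (Word k (suc m)) 0ℓ
Arc s t = tail s ≡ init t

DepthAssignment : ℕ → ℕ → Set
DepthAssignment k n = Word k n → Fin k

ValidArc : ∀ {k m} → DepthAssignment k (suc m) → Rel (Word k (suc m)) 0ℓ
ValidArc d s t = Arc s t × ((b ⊕ 1 ≡ c × d s ≡ d t) ⊎ (b ⊕ 1 ≡ d t × c ≡ d s))
  where
  b = head s
  c = last t

-- For N = 1 this asks for a loop, and for N = 2 for a pair of opposite arcs.
IsHamiltonianCycle : {A : Set} → Rel A 0ℓ → ∀ {N} → (Fin N → A) → Set
IsHamiltonianCycle _⟶_ s = Bijective _≡_ _≡_ s × (∀ i → s i ⟶ s (i ⊕ 1))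

CircularString : ℕ → ℕ → Set
CircularString k N = Fin N → Fin k

-- The length l may exceed N, in which case the substring wraps around; this
-- occurs in IsDeBruijn only for k = 1.
substring : ∀ {k N} → CircularString k N → Fin N → (l : ℕ) → Word k l
substring w i l = tabulate (λ j → w (i ⊕ toℕ j))

IsDeBruijn : ∀ {k} n → CircularString k (k ^ n) → Set
IsDeBruijn {k} n w = (u : Word k n) → ∃! _≡_ (λ i → substring w i n ≡ u)

occurrences : ∀ {k l} → Word k l → Fin k → ℕ
occurrences s a = count (a ≟_) s

-- Every count lies between 0 and l, so for k ≥ 1 the default values 0 and l
-- do not affect the maximum and the minimum.
spread : ∀ {k l} → Word k l → ℕ
spread {k} {l} s = max 0 counts ∸ min l counts
  where
  counts : List ℕ
  counts = List.map (occurrences s) (allFin k)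

-- Substrings of a circular string of length N have length at most N.
discrepancy : ∀ {k N} → CircularString k N → ℕ
discrepancy {N = N} w =
  max 0 (cartesianProductWith (λ i l → spread (substring w i l)) (allFin N) (upTo (suc N)))

{-# OPTIONS --safe #-}

-- Validity of an arc (s, t) says that, as multisets, {t[n-1], d_t} = {s[0]+1, d_s}.
-- Let f_s(a) be the number of occurrences of a in the word d_s s of length n+1.
-- Following one arc therefore gives [s[0] = a+1] + f_t(a+1) = [s[0] = a] + f_s(a+1),
-- and summing along a walk from s to t that spells the word u gives
-- |u|_{a+1} - |u|_a = f_s(a+1) - f_t(a+1).  Summing once more over the symbols
-- b+1, ..., b+r with r < k, which are distinct, bounds |u|_{b+r} - |u|_b by the
-- total number n+1 of symbols in d_s s.
module Submission where

open import Defs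
open import Data.Nat using (ℕ; zero; suc; _+_; _∸_; _^_; _≤_; _<_; z≤n; s≤s)
open import Data.Nat.Properties hiding (_≟_)
open import Data.Nat.DivMod using (_%_; m%n<n; m%n%n≡m%n; [m+n]%n≡m%n; m<n⇒m%n≡m; %-distribˡ-+)
open import Data.Nat.Solver using (module +-*-Solver)
open import Algebra.Properties.CommutativeSemigroup +-commutativeSemigroup using (interchange; x∙yz≈y∙xz; x∙yz≈yx∙z; xy∙z≈y∙xz)
open import Data.Bool using (true; false)
open import Data.Fin using (Fin; toℕ; fromℕ<; _≟_)
open import Data.Fin.Properties using (nonZeroIndex; toℕ-fromℕ<; toℕ-injective; toℕ<n; toℕ≤n)
open import Data.List using (allFin; upTo)
open import Data.List.Extrema.Nat using (max≤v⁺; v≤min⁺)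
import Data.List.Relation.Unary.All.Properties as All
open import Data.Product using (_×_; _,_; proj₁; ∃)
open import Data.Sum using (inj₁; inj₂)
open import Data.Vec using (Vec; []; _∷_; [_]; head; tail; init; last; tabulate)
open import Data.Vec.Properties using (count≤n; tabulate-cong)
open import Function using (_∘_)
open import Relation.Nullary using (yes; no; does; contradiction)
open import Relation.Binary.PropositionalEquality using (_≡_; refl; sym; trans; cong; cong₂; subst; setoid; module ≡-Reasoning)

private
  variable
    k l m N : ℕ

-- Arithmetic of `_⊕_`, common to symbols and circular positions.

toℕ-⊕ : (i : Fin N) (j : ℕ) → toℕ (i ⊕ j) ≡ ((toℕ i + j) % N) {{nonZeroIndex i}}
toℕ-⊕ {N} i j = toℕ-fromℕ< (m%n<n (toℕ i + j) N {{nonZeroIndex i}})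

⊕-identityʳ : (i : Fin N) → i ⊕ 0 ≡ i
⊕-identityʳ {N = suc _} i = toℕ-injective (begin
  toℕ (i ⊕ 0)       ≡⟨ toℕ-⊕ i 0 ⟩
  (toℕ i + 0) % _   ≡⟨ cong (_% _) (+-identityʳ (toℕ i)) ⟩
  toℕ i % _         ≡⟨ m<n⇒m%n≡m (toℕ<n i) ⟩
  toℕ i             ∎)
  where open ≡-Reasoning

⊕-period : (i : Fin N) → i ⊕ N ≡ i
⊕-period {N = N@(suc _)} i = toℕ-injective (begin
  toℕ (i ⊕ N)       ≡⟨ toℕ-⊕ i N ⟩
  (toℕ i + N) % N   ≡⟨ [m+n]%n≡m%n (toℕ i) N ⟩
  toℕ i % N         ≡⟨ m<n⇒m%n≡m (toℕ<n i) ⟩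
  toℕ i             ∎)
  where open ≡-Reasoning

⊕-assoc : (i : Fin N) (p q : ℕ) → i ⊕ p ⊕ q ≡ i ⊕ (p + q)
⊕-assoc {N = N@(suc _)} i p q = toℕ-injective (begin
  toℕ (i ⊕ p ⊕ q)                     ≡⟨ toℕ-⊕ (i ⊕ p) q ⟩
  (toℕ (i ⊕ p) + q) % N               ≡⟨ cong (λ x → (x + q) % N) (toℕ-⊕ i p) ⟩
  (x % N + q) % N                     ≡⟨ %-distribˡ-+ (x % N) q N ⟩
  (x % N % N + q % N) % N             ≡⟨ cong (λ y → (y + q % N) % N) (m%n%n≡m%n x N) ⟩
  (x % N + q % N) % N                 ≡⟨ %-distribˡ-+ x q N ⟨
  (x + q) % N                         ≡⟨ cong (_% N) (+-assoc (toℕ i) p q) ⟩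
  (toℕ i + (p + q)) % N               ≡⟨ toℕ-⊕ i (p + q) ⟨
  toℕ (i ⊕ (p + q))                   ∎)
  where
  open ≡-Reasoning
  x = toℕ i + p

⊕-suc : (i : Fin N) (p : ℕ) → i ⊕ suc p ≡ i ⊕ p ⊕ 1
⊕-suc i p = trans (cong (i ⊕_) (+-comm 1 p)) (sym (⊕-assoc i p 1))

⊕-comm : (i j : Fin N) → i ⊕ toℕ j ≡ j ⊕ toℕ i
⊕-comm {N = N@(suc _)} i j = toℕ-injective (begin
  toℕ (i ⊕ toℕ j)       ≡⟨ toℕ-⊕ i (toℕ j) ⟩
  (toℕ i + toℕ j) % N   ≡⟨ cong (_% N) (+-comm (toℕ i) (toℕ j)) ⟩
  (toℕ j + toℕ i) % N   ≡⟨ toℕ-⊕ j (toℕ i) ⟨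
  toℕ (j ⊕ toℕ i)       ∎)
  where open ≡-Reasoning

-- Adding `N ∸ p` completes the shift by `p` to a full period; `p ≤ N` makes this truncated
-- subtraction exact.
⊕-cancelʳ : ∀ p {i j : Fin N} → p ≤ N → i ⊕ p ≡ j ⊕ p → i ≡ j
⊕-cancelʳ {N} p {i} {j} p≤N eq = begin
  i                 ≡⟨ undo i ⟨
  i ⊕ p ⊕ (N ∸ p)   ≡⟨ cong (_⊕ (N ∸ p)) eq ⟩
  j ⊕ p ⊕ (N ∸ p)   ≡⟨ undo j ⟩
  j                 ∎
  where
  open ≡-Reasoning
  undo : (i : Fin N) → i ⊕ p ⊕ (N ∸ p) ≡ i
  undo i = trans (⊕-assoc i p (N ∸ p)) (trans (cong (i ⊕_) (m+[n∸m]≡n p≤N)) (⊕-period i))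

⊕-cancelˡ : (i : Fin N) {p q : ℕ} → p < N → q < N → i ⊕ p ≡ i ⊕ q → p ≡ q
⊕-cancelˡ i {p} {q} p<N q<N eq = begin
  p                   ≡⟨ toℕ-fromℕ< p<N ⟨
  toℕ (fromℕ< p<N)    ≡⟨ cong toℕ (⊕-cancelʳ (toℕ i) (toℕ≤n i) eq′) ⟩
  toℕ (fromℕ< q<N)    ≡⟨ toℕ-fromℕ< q<N ⟩
  q                   ∎
  where
  open ≡-Reasoning
  swap : ∀ {r} (r<N : r < _) → fromℕ< r<N ⊕ toℕ i ≡ i ⊕ r
  swap r<N = trans (⊕-comm (fromℕ< r<N) i) (cong (i ⊕_) (toℕ-fromℕ< r<N))
  eq′ : fromℕ< p<N ⊕ toℕ i ≡ fromℕ< q<N ⊕ toℕ i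
  eq′ = trans (swap p<N) (trans eq (sym (swap q<N)))

⊕-difference : (i j : Fin N) → ∃ λ r → r < N × i ⊕ r ≡ j
⊕-difference {N} i j = toℕ r , toℕ<n r , (begin
  i ⊕ toℕ r                   ≡⟨ ⊕-comm i r ⟩
  j ⊕ (N ∸ toℕ i) ⊕ toℕ i     ≡⟨ ⊕-assoc j (N ∸ toℕ i) (toℕ i) ⟩
  j ⊕ (N ∸ toℕ i + toℕ i)     ≡⟨ cong (j ⊕_) (m∸n+n≡m (toℕ≤n i)) ⟩
  j ⊕ N                       ≡⟨ ⊕-period j ⟩
  j                           ∎)
  where
  open ≡-Reasoning
  -- `N ∸ toℕ i` stands for -i, so `r` represents j - i.
  r = j ⊕ (N ∸ toℕ i)

-- Occurrences of single symbols.

occurrences-∷ : ∀ x (u : Word k l) a →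
  occurrences (x ∷ u) a ≡ occurrences [ x ] a + occurrences u a
occurrences-∷ x u a with does (a ≟ x)
... | true  = refl
... | false = refl

-- An arc (s, t) identifies `tail s` with `init t`, so the target has to be taken apart at its end.
occurrences-init-last : (u : Word k (suc m)) (a : Fin k) →
  occurrences u a ≡ occurrences (init u) a + occurrences [ last u ] a
occurrences-init-last (x ∷ [])        a = refl
occurrences-init-last (x ∷ u@(_ ∷ _)) a = begin
  occurrences (x ∷ u) a                                                         ≡⟨ occurrences-∷ x u a ⟩
  occurrences [ x ] a + occurrences u a                                         ≡⟨ cong (occurrences [ x ] a +_) (occurrences-init-last u a) ⟩
  occurrences [ x ] a + (occurrences (init u) a + occurrences [ last u ] a)     ≡⟨ +-assoc (occurrences [ x ] a) _ _ ⟨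
  occurrences [ x ] a + occurrences (init u) a + occurrences [ last u ] a       ≡⟨ cong (_+ occurrences [ last u ] a) (occurrences-∷ x (init u) a) ⟨
  occurrences (x ∷ init u) a + occurrences [ last u ] a                         ∎
  where open ≡-Reasoning

-- `occurrences [ x ]` is the indicator function of `x`. Adding 1 modulo k is injective, so the
-- indicator moves along with its point.
occurrences-shift : (x a : Fin k) → occurrences [ x ⊕ 1 ] (a ⊕ 1) ≡ occurrences [ x ] a
occurrences-shift x a with a ≟ x | a ⊕ 1 ≟ x ⊕ 1
... | yes _   | yes _  = refl
... | yes a≡x | no ¬eq = contradiction (cong (_⊕ 1) a≡x) ¬eq
-- The existence of `x` gives `1 ≤ k`, which cancelling 1 requires.
... | no a≢x  | yes eq = contradiction (⊕-cancelʳ 1 (≤-trans (s≤s z≤n) (toℕ<n x)) eq) a≢x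
... | no _    | no _   = refl

-- Occurrences summed over a run of cyclically consecutive symbols.

-- The symbols counted are b ⊕ 1, …, b ⊕ r; b itself is excluded.
arcOccurrences : Word k l → Fin k → ℕ → ℕ
arcOccurrences u b zero    = 0
arcOccurrences u b (suc r) = occurrences u (b ⊕ suc r) + arcOccurrences u b r

arcOccurrences-[] : (b : Fin k) (r : ℕ) → arcOccurrences [] b r ≡ 0
arcOccurrences-[] b zero    = refl
arcOccurrences-[] b (suc r) = arcOccurrences-[] b r

arcOccurrences-∷ : ∀ x (u : Word k l) b r →
  arcOccurrences (x ∷ u) b r ≡ arcOccurrences [ x ] b r + arcOccurrences u b r
arcOccurrences-∷ x u b zero    = refl
arcOccurrences-∷ x u b (suc r) = begin
  occurrences (x ∷ u) (b ⊕ suc r) + arcOccurrences (x ∷ u) b r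
    ≡⟨ cong₂ _+_ (occurrences-∷ x u (b ⊕ suc r)) (arcOccurrences-∷ x u b r) ⟩
  (occurrences [ x ] (b ⊕ suc r) + occurrences u (b ⊕ suc r)) + (arcOccurrences [ x ] b r + arcOccurrences u b r)
    ≡⟨ interchange (occurrences [ x ] (b ⊕ suc r)) _ _ _ ⟩
  (occurrences [ x ] (b ⊕ suc r) + arcOccurrences [ x ] b r) + (occurrences u (b ⊕ suc r) + arcOccurrences u b r)
    ∎
  where
  open ≡-Reasoning

-- Offsets below k name distinct symbols, so no offset smaller than `q` reaches `b ⊕ q`.
arcOccurrences-beyond : (b : Fin k) {r q : ℕ} → r < q → q < k → arcOccurrences [ b ⊕ q ] b r ≡ 0
arcOccurrences-beyond b {zero}  {q} r<q q<k = refl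
arcOccurrences-beyond b {suc r} {q} r<q q<k with b ⊕ suc r ≟ b ⊕ q
... | yes eq = contradiction (⊕-cancelˡ b (<-trans r<q q<k) q<k eq) (<⇒≢ r<q)
... | no _   = arcOccurrences-beyond b (<-trans (n<1+n r) r<q) q<k

arcOccurrences-[x]≤1 : ∀ x (b : Fin k) {r} → r < k → arcOccurrences [ x ] b r ≤ 1
arcOccurrences-[x]≤1 x b {zero}  r<k = z≤n
arcOccurrences-[x]≤1 x b {suc r} r<k with b ⊕ suc r ≟ x
-- Here `x` is the last symbol of the run, so the shorter run cannot contain it again.
... | yes refl = s≤s (≤-reflexive (arcOccurrences-beyond b (n<1+n r) r<k))
... | no _     = arcOccurrences-[x]≤1 x b (<-trans (n<1+n r) r<k)

arcOccurrences≤length : (u : Word k l) (b : Fin k) {r : ℕ} → r < k → arcOccurrences u b r ≤ l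
arcOccurrences≤length []      b {r} r<k = ≤-reflexive (arcOccurrences-[] b r)
arcOccurrences≤length (x ∷ u) b {r} r<k = begin
  arcOccurrences (x ∷ u) b r                        ≡⟨ arcOccurrences-∷ x u b r ⟩
  arcOccurrences [ x ] b r + arcOccurrences u b r   ≤⟨ +-mono-≤ (arcOccurrences-[x]≤1 x b r<k) (arcOccurrences≤length u b r<k) ⟩
  suc _                                             ∎
  where open ≤-Reasoning

-- Words spelled by walks in the de Bruijn graph.

trace : (ℕ → Word k (suc m)) → (l : ℕ) → Word k l
trace S l = tabulate (λ j → head (S (toℕ j)))

head-init : {A : Set} (u : Vec A (suc (suc m))) → head (init u) ≡ head u
head-init (_ ∷ _ ∷ _) = refl

tail-init : {A : Set} (u : Vec A (suc (suc m))) → tail (init u) ≡ init (tail u)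
tail-init (_ ∷ _ ∷ _) = refl

-- Induction on the order of the graph: applying `init` to every node of a walk gives a walk of
-- order one less. From `S 1` it spells `init (S 1)`, which is `tail (S 0)`.
trace-walk : (S : ℕ → Word k (suc m)) → (∀ j → Arc (S j) (S (suc j))) → trace S (suc m) ≡ S 0
trace-walk {m = zero}  S arc with S 0
... | x ∷ [] = refl
trace-walk {k} {suc m} S arc = begin
  trace S (suc (suc m))                        ≡⟨⟩
  head (S 0) ∷ trace (S ∘ suc) (suc m)         ≡⟨ cong (head (S 0) ∷_) (tabulate-cong (head-init ∘ S ∘ suc ∘ toℕ)) ⟨
  head (S 0) ∷ trace (init ∘ S ∘ suc) (suc m)  ≡⟨ cong (head (S 0) ∷_) (trace-walk (init ∘ S ∘ suc) arc′) ⟩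
  head (S 0) ∷ init (S 1)                      ≡⟨ cong (head (S 0) ∷_) (arc 0) ⟨
  head (S 0) ∷ tail (S 0)                      ≡⟨ head∷tail (S 0) ⟩
  S 0                                          ∎
  where
  open ≡-Reasoning
  head∷tail : ∀ {n} (u : Word k (suc n)) → head u ∷ tail u ≡ u
  head∷tail (_ ∷ _) = refl
  arc′ : ∀ j → Arc (init (S (suc j))) (init (S (suc (suc j))))
  arc′ j = trans (tail-init (S (suc j))) (cong init (arc (suc j)))

-- Balance of symbol counts along valid walks.

module _ (d : DepthAssignment k (suc m)) where

  -- `occurrences (load s)` is the function f_s.
  load : Word k (suc m) → Word k (suc (suc m))
  load s = d s ∷ s

  load-∷ : ∀ s a → occurrences (load s) a ≡
    occurrences [ d s ] a + (occurrences [ head s ] a + occurrences (tail s) a)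
  load-∷ s@(x ∷ u) a =
    trans (occurrences-∷ (d s) s a) (cong (occurrences [ d s ] a +_) (occurrences-∷ x u a))

  load-init-last : ∀ t a → occurrences (load t) a ≡
    occurrences [ d t ] a + (occurrences (init t) a + occurrences [ last t ] a)
  load-init-last t a =
    trans (occurrences-∷ (d t) t a) (cong (occurrences [ d t ] a +_) (occurrences-init-last t a))

  -- The two alternatives of validity match the two pairs of symbols crosswise and in order,
  -- respectively; counting cannot tell them apart.
  exchange : ∀ {s t} → ValidArc d s t → ∀ a →
    occurrences [ d t ] a + occurrences [ last t ] a ≡
    occurrences [ head s ⊕ 1 ] a + occurrences [ d s ] a
  exchange (_ , inj₁ (b+1≡c , ds≡dt)) a rewrite b+1≡c | ds≡dt = +-comm (occurrences [ _ ] a) _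
  exchange (_ , inj₂ (b+1≡dt , c≡ds)) a rewrite b+1≡dt | c≡ds = refl

  -- The summand for `head s` on the left completes the shared middle word `init t`, that is
  -- `tail s`, to `s`. By `exchange`, the two other symbols of `load t` become `head s ⊕ 1` and
  -- `d s`.
  load-arc : ∀ {s t} → ValidArc d s t → ∀ a →
    occurrences [ head s ] (a ⊕ 1) + occurrences (load t) (a ⊕ 1) ≡
    occurrences [ head s ] a + occurrences (load s) (a ⊕ 1)
  load-arc {s} {t} valid@(arc , _) a = begin
    δ (head s) + occurrences (load t) a⁺                              ≡⟨ cong (δ (head s) +_) (load-init-last t a⁺) ⟩
    δ (head s) + (δ (d t) + (occurrences (init t) a⁺ + δ (last t)))   ≡⟨ solve 4 (λ h e i c → h :+ (e :+ (i :+ c)) := (e :+ c) :+ (h :+ i)) refl (δ (head s)) (δ (d t)) (occurrences (init t) a⁺) (δ (last t)) ⟩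
    (δ (d t) + δ (last t)) + (δ (head s) + occurrences (init t) a⁺)   ≡⟨ cong₂ (λ x u → x + (δ (head s) + occurrences u a⁺)) (exchange valid a⁺) (sym arc) ⟩
    (δ (head s ⊕ 1) + δ (d s)) + (δ (head s) + occurrences (tail s) a⁺) ≡⟨ +-assoc (δ (head s ⊕ 1)) _ _ ⟩
    δ (head s ⊕ 1) + (δ (d s) + (δ (head s) + occurrences (tail s) a⁺)) ≡⟨ cong₂ _+_ (occurrences-shift (head s) a) (sym (load-∷ s a⁺)) ⟩
    occurrences [ head s ] a + occurrences (load s) a⁺                ∎
    where
    open ≡-Reasoning
    open +-*-Solver
    a⁺ = a ⊕ 1
    δ : Fin k → ℕ
    δ x = occurrences [ x ] a⁺

  -- The induction removes the first arc, and `load-arc` trades the load of `S 1` for that of `S 0`.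
  -- The identity stays additive because the differences may be negative.
  load-walk : (S : ℕ → Word k (suc m)) → (∀ j → ValidArc d (S j) (S (suc j))) → ∀ l a →
    occurrences (trace S l) (a ⊕ 1) + occurrences (load (S l)) (a ⊕ 1) ≡
    occurrences (trace S l) a + occurrences (load (S 0)) (a ⊕ 1)
  load-walk S valid zero    a = refl
  load-walk S valid (suc l) a = begin
    occurrences (trace S (suc l)) a⁺ + occurrences (load (S (suc l))) a⁺  ≡⟨ cong (_+ occurrences (load (S (suc l))) a⁺) (occurrences-∷ x u a⁺) ⟩
    (x⁺ + occurrences u a⁺) + occurrences (load (S (suc l))) a⁺           ≡⟨ +-assoc x⁺ _ _ ⟩
    x⁺ + (occurrences u a⁺ + occurrences (load (S (suc l))) a⁺)           ≡⟨ cong (x⁺ +_) (load-walk (S ∘ suc) (valid ∘ suc) l a) ⟩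
    x⁺ + (occurrences u a + occurrences (load (S 1)) a⁺)                  ≡⟨ x∙yz≈y∙xz x⁺ (occurrences u a) (occurrences (load (S 1)) a⁺) ⟩
    occurrences u a + (x⁺ + occurrences (load (S 1)) a⁺)                  ≡⟨ cong (occurrences u a +_) (load-arc (valid 0) a) ⟩
    occurrences u a + (x⁰ + occurrences (load (S 0)) a⁺)                  ≡⟨ x∙yz≈yx∙z (occurrences u a) x⁰ (occurrences (load (S 0)) a⁺) ⟩
    (x⁰ + occurrences u a) + occurrences (load (S 0)) a⁺                  ≡⟨ cong (_+ occurrences (load (S 0)) a⁺) (occurrences-∷ x u a) ⟨
    occurrences (trace S (suc l)) a + occurrences (load (S 0)) a⁺         ∎
    where
    open ≡-Reasoning
    a⁺ = a ⊕ 1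
    x = head (S 0)
    u = trace (S ∘ suc) l
    x⁺ = occurrences [ x ] a⁺
    x⁰ = occurrences [ x ] a

  -- Chaining `load-walk` from `b` to `b ⊕ r` cancels the counts of the intermediate symbols in the
  -- trace, while the loads accumulate.
  arc-load-walk : (S : ℕ → Word k (suc m)) → (∀ j → ValidArc d (S j) (S (suc j))) → ∀ l b r →
    occurrences (trace S l) (b ⊕ r) + arcOccurrences (load (S l)) b r ≡
    occurrences (trace S l) b + arcOccurrences (load (S 0)) b r
  arc-load-walk S valid l b zero    = cong (λ a → occurrences (trace S l) a + 0) (⊕-identityʳ b)
  arc-load-walk S valid l b (suc r) = begin
    C (b ⊕ suc r) + (f l (b ⊕ suc r) + F l)   ≡⟨ +-assoc (C (b ⊕ suc r)) _ _ ⟨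
    (C (b ⊕ suc r) + f l (b ⊕ suc r)) + F l   ≡⟨ cong (_+ F l) step ⟩
    (C (b ⊕ r) + f 0 (b ⊕ suc r)) + F l       ≡⟨ xy∙z≈y∙xz (C (b ⊕ r)) _ _ ⟩
    f 0 (b ⊕ suc r) + (C (b ⊕ r) + F l)       ≡⟨ cong (f 0 (b ⊕ suc r) +_) (arc-load-walk S valid l b r) ⟩
    f 0 (b ⊕ suc r) + (C b + F 0)             ≡⟨ x∙yz≈y∙xz (f 0 (b ⊕ suc r)) (C b) (F 0) ⟩
    C b + (f 0 (b ⊕ suc r) + F 0)             ∎
    where
    open ≡-Reasoning
    C : Fin k → ℕ
    C = occurrences (trace S l)
    f : ℕ → Fin k → ℕ
    f j = occurrences (load (S j))
    F : ℕ → ℕ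
    F j = arcOccurrences (load (S j)) b r
    step : C (b ⊕ suc r) + f l (b ⊕ suc r) ≡ C (b ⊕ r) + f 0 (b ⊕ suc r)
    step = subst (λ a → C a + f l a ≡ C (b ⊕ r) + f 0 a) (sym (⊕-suc b r)) (load-walk S valid l (b ⊕ r))

  occurrences-trace-balanced : (S : ℕ → Word k (suc m)) → (∀ j → ValidArc d (S j) (S (suc j))) →
    ∀ l a b → occurrences (trace S l) a ≤ suc (suc m) + occurrences (trace S l) b
  occurrences-trace-balanced S valid l a b with ⊕-difference b a
  ... | r , r<k , refl = begin
    C (b ⊕ r)                                          ≤⟨ m≤m+n _ _ ⟩
    C (b ⊕ r) + arcOccurrences (load (S l)) b r        ≡⟨ arc-load-walk S valid l b r ⟩
    -- Only the initial load remains; its length `suc (suc m)` is n + 1, the constant of the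
    -- theorem.
    C b + arcOccurrences (load (S 0)) b r              ≤⟨ +-monoʳ-≤ (C b) (arcOccurrences≤length (load (S 0)) b r<k) ⟩
    C b + suc (suc m)                                  ≡⟨ +-comm (C b) _ ⟩
    suc (suc m) + C b                                  ∎
    where
    open ≤-Reasoning
    C : Fin k → ℕ
    C = occurrences (trace S l)

-- From symbol counts to spread and discrepancy.

spread≤ : (u : Word k l) {c : ℕ} → (∀ a b → occurrences u a ≤ c + occurrences u b) → spread u ≤ c
spread≤ {k} {l} u {c} balanced = m≤n+o⇒m∸n≤o _ _
  -- `z≤n` settles the default value 0 of `max`.
  (max≤v⁺ z≤n (All.map⁺ {xs = allFin k} (All.tabulate⁺ bound)))
  where
  open ≤-Reasoning
  bound : ∀ a → occurrences u a ≤ _ + c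
  bound a = begin
    occurrences u a               ≤⟨ m≤n+m∸n (occurrences u a) c ⟩
    c + (occurrences u a ∸ c)     ≤⟨ +-monoʳ-≤ c (v≤min⁺
      -- The default value `l` of `min` also needs a lower bound: no count exceeds the length of the
      -- word.
      (≤-trans (m∸n≤m _ c) (count≤n (a ≟_) u))
      (All.map⁺ {xs = allFin k} (All.tabulate⁺ λ b → m≤n+o⇒m∸n≤o _ c (balanced a b)))) ⟩
    c + _                         ≡⟨ +-comm c _ ⟩
    _ + c                         ∎

discrepancy≤ : (w : CircularString k N) {c : ℕ} → (∀ i l → spread (substring w i l) ≤ c) → discrepancy w ≤ c
discrepancy≤ {N = N} w bound = max≤v⁺ z≤n
  (All.cartesianProductWith⁺ (setoid _) (setoid _) _ (allFin N) (upTo (suc N)) λ _ _ → bound _ _)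

theorem2 : (k m : ℕ) → 1 ≤ k →
    let n = suc m in
    (d : DepthAssignment k n) (s : Fin (k ^ n) → Word k n) →
    IsHamiltonianCycle (ValidArc d) s →
    let w : CircularString k (k ^ n)
        w = λ i → head (s i)
    in IsDeBruijn n w × discrepancy w ≤ n + 1
theorem2 k m _ d s ((injective , surjective) , valid) = deBruijn , discrepancy≤ w balanced
  where
  n = suc m
  w : CircularString k (k ^ n)
  w i = head (s i)

  -- The cycle is unrolled into an endless walk from position `i`, whose shifts are again walks.
  -- `trace (walk i) l` and `substring w i l` agree by definition.
  walk : Fin (k ^ n) → ℕ → Word k n
  walk i j = s (i ⊕ j)

  walk-valid : ∀ i j → ValidArc d (walk i j) (walk i (suc j))
  walk-valid i j = subst (ValidArc d (walk i j) ∘ s) (sym (⊕-suc i j)) (valid (i ⊕ j))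

  substring-node : ∀ i → substring w i n ≡ s i
  substring-node i =
    trans (trace-walk (walk i) (proj₁ ∘ walk-valid i)) (cong s (⊕-identityʳ i))

  deBruijn : IsDeBruijn n w
  deBruijn u with surjective u
  -- Since the substring at `i` is the node `s i`, surjectivity of `s` gives the occurrence of `u`
  -- and injectivity its uniqueness.
  ... | i , s[i]≡u = i , trans (substring-node i) (s[i]≡u refl) ,
    λ {j} eq → injective (trans (s[i]≡u refl) (trans (sym eq) (substring-node j)))

  balanced : ∀ i l → spread (substring w i l) ≤ n + 1
  balanced i l = subst (spread (substring w i l) ≤_) (+-comm 1 n)
    (spread≤ (substring w i l) (occurrences-trace-balanced d (walk i) (walk-valid i) l))
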